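{- Let $n \ge 2$ be an integer, let $G = \mathbb{Z}/n\mathbb{Z}$, and let $p(G)$ be the smallest prime dividing $n$. Let $A, B \subseteq G$ with $|A| = k$ and $|B| = l$, where $k, l \geq 3$, and suppose that $p(G) > k + l - 3$. Suppose further that $A$ and $B$ are arithmetic progressions with the same common difference, i.e. there exist $a, b, d \in G$ with $A = \{a + sd \mid 0 \le s \le k-1\}$ and $B = \{b + td \mid 0 \le t \le l-1\}$. If $|A \dot{+} B| = |A| + |B| - 3$, then $A = B$.
   Context: For subsets $A, B$ of an abelian group (written additively), the restricted sumset is $A \dot{+} B := \{a + b \mid a \in A,\ b \in B,\ a \neq b\}$. -}

module Defs where

open import Algebra.Bundles using (AbelianGroup)
open import Algebra.Definitions.RawMonoid using () renaming (_×_ to multiple)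
open import Algebra.Structures using (IsAbelianGroup)
open import Data.Bool.Properties using (T-≡)
open import Data.Fin.Base using (Fin; toℕ)
open import Data.Fin.Properties using (toℕ-injective; toℕ-fromℕ<; toℕ<n; any?; _≟_)
open import Data.Fin.Subset using (Subset; _∈_)
open import Data.Fin.Subset.Properties using (_∈?_)
open import Data.Nat.Base using (ℕ; _+_; _∸_; _%_; _≤_; _<_; NonZero; >-nonZero⁻¹)
open import Data.Nat.Divisibility using (_∣_)
open import Data.Nat.DivMod using (_mod_; m%n<n; %-distribˡ-+; m%n%n≡m%n; m<n⇒m%n≡m; n%n≡0)
open import Data.Nat.Primality using (Prime)
open import Data.Nat.Properties using (+-comm; +-assoc; m∸n+n≡m; <⇒≤)
open import Data.Product.Base using (∃-syntax; _×_; _,_)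
open import Data.Vec.Base using (tabulate)
open import Data.Vec.Properties using (lookup⇒[]=; []=⇒lookup; lookup∘tabulate)
open import Function.Bundles using (_⇔_; mk⇔; Equivalence)
open import Level using (0ℓ)
open import Relation.Binary.PropositionalEquality
open import Relation.Nullary.Decidable using (Dec; does; ¬?; _×-dec_; toWitness; fromWitness; isYes≗does)

------------------------------------------------------------------------
-- The group ℤ/nℤ, with the residues 0, …, n - 1 as elements

module _ {n : ℕ} .{{_ : NonZero n}} where

  infixl 6 _⊕_

  _⊕_ : Fin n → Fin n → Fin n
  x ⊕ y = (toℕ x + toℕ y) mod n

  𝟘 : Fin n
  𝟘 = 0 mod n

  ⊖_ : Fin n → Fin n
  ⊖ x = (n ∸ toℕ x) mod n

  private
    toℕ-mod : ∀ m → toℕ (m mod n) ≡ m % n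
    toℕ-mod m = toℕ-fromℕ< (m%n<n m n)

    mod-cong : ∀ {a b} → a % n ≡ b % n → a mod n ≡ b mod n
    mod-cong {a} {b} eq = toℕ-injective (trans (toℕ-mod a) (trans eq (sym (toℕ-mod b))))

    mod-toℕ : ∀ (x : Fin n) → toℕ x mod n ≡ x
    mod-toℕ x = toℕ-injective (trans (toℕ-mod (toℕ x)) (m<n⇒m%n≡m (toℕ<n x)))

    %-absorbˡ : ∀ a b → (a % n + b) % n ≡ (a + b) % n
    %-absorbˡ a b = begin
      (a % n + b) % n          ≡⟨ %-distribˡ-+ (a % n) b n ⟩
      (a % n % n + b % n) % n  ≡⟨ cong (λ z → (z + b % n) % n) (m%n%n≡m%n a n) ⟩
      (a % n + b % n) % n      ≡⟨ %-distribˡ-+ a b n ⟨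
      (a + b) % n              ∎
      where open ≡-Reasoning

    mod-absorbˡ : ∀ a b → (toℕ (a mod n) + b) mod n ≡ (a + b) mod n
    mod-absorbˡ a b = mod-cong
      (trans (cong (λ z → (z + b) % n) (toℕ-mod a)) (%-absorbˡ a b))

  ⊕-comm : ∀ x y → x ⊕ y ≡ y ⊕ x
  ⊕-comm x y = cong (_mod n) (+-comm (toℕ x) (toℕ y))

  ⊕-assoc : ∀ x y z → (x ⊕ y) ⊕ z ≡ x ⊕ (y ⊕ z)
  ⊕-assoc x y z = begin
    (x ⊕ y) ⊕ z                      ≡⟨ mod-absorbˡ (toℕ x + toℕ y) (toℕ z) ⟩
    (toℕ x + toℕ y + toℕ z) mod n    ≡⟨ cong (_mod n) (+-assoc (toℕ x) (toℕ y) (toℕ z)) ⟩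
    (toℕ x + (toℕ y + toℕ z)) mod n  ≡⟨ cong (_mod n) (+-comm (toℕ x) _) ⟩
    (toℕ y + toℕ z + toℕ x) mod n    ≡⟨ mod-absorbˡ (toℕ y + toℕ z) (toℕ x) ⟨
    (y ⊕ z) ⊕ x                      ≡⟨ ⊕-comm (y ⊕ z) x ⟩
    x ⊕ (y ⊕ z)                      ∎
    where open ≡-Reasoning

  ⊕-identityˡ : ∀ x → 𝟘 ⊕ x ≡ x
  ⊕-identityˡ x = trans (mod-absorbˡ 0 (toℕ x)) (mod-toℕ x)

  ⊕-inverseˡ : ∀ x → (⊖ x) ⊕ x ≡ 𝟘
  ⊕-inverseˡ x = begin
    (⊖ x) ⊕ x                  ≡⟨ mod-absorbˡ (n ∸ toℕ x) (toℕ x) ⟩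
    (n ∸ toℕ x + toℕ x) mod n  ≡⟨ cong (_mod n) (m∸n+n≡m (<⇒≤ (toℕ<n x))) ⟩
    n mod n                    ≡⟨ mod-cong (trans (n%n≡0 n) (sym (m<n⇒m%n≡m n>0))) ⟩
    𝟘                          ∎
    where
    open ≡-Reasoning
    n>0 : 0 < n
    n>0 = >-nonZero⁻¹ n

  ⊕-isAbelianGroup : IsAbelianGroup _≡_ _⊕_ 𝟘 ⊖_
  ⊕-isAbelianGroup = record
    { isGroup = record
      { isMonoid = record
        { isSemigroup = record
          { isMagma = record { isEquivalence = isEquivalence ; ∙-cong = cong₂ _⊕_ }
          ; assoc = ⊕-assoc
          }
        ; identity = ⊕-identityˡ , λ x → trans (⊕-comm x 𝟘) (⊕-identityˡ x)
        }
      ; inverse = ⊕-inverseˡ , λ x → trans (⊕-comm x (⊖ x)) (⊕-inverseˡ x)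
      ; ⁻¹-cong = cong ⊖_
      }
    ; comm = ⊕-comm
    }

ℤ/ : (n : ℕ) .{{_ : NonZero n}} → AbelianGroup 0ℓ 0ℓ
ℤ/ n = record { isAbelianGroup = ⊕-isAbelianGroup {n} }

module _ {n : ℕ} .{{_ : NonZero n}} where

  infixr 8 _·_

  _·_ : ℕ → Fin n → Fin n
  _·_ = multiple (AbelianGroup.rawMonoid (ℤ/ n))

  ------------------------------------------------------------------------
  -- Restricted sumsets

  private
    ∔-member? : (A B : Subset n) (x : Fin n) →
                Dec (∃[ a ] ∃[ b ] (a ∈ A × b ∈ B × a ≢ b × x ≡ a ⊕ b))
    ∔-member? A B x = any? λ a → any? λ b →
      (a ∈? A) ×-dec (b ∈? B) ×-dec ¬? (a ≟ b) ×-dec (x ≟ a ⊕ b)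

  infixl 6 _∔_

  -- Built by deciding membership, so that the cardinality of Data.Fin.Subset
  -- applies; ∈-∔ is the set-builder description.
  _∔_ : Subset n → Subset n → Subset n
  A ∔ B = tabulate λ x → does (∔-member? A B x)

  ∈-∔ : ∀ {A B x} → x ∈ A ∔ B ⇔ (∃[ a ] ∃[ b ] (a ∈ A × b ∈ B × a ≢ b × x ≡ a ⊕ b))
  ∈-∔ {A} {B} {x} = mk⇔
    (λ x∈ → toWitness {a? = D} (Equivalence.from T-≡
      (trans (isYes≗does D) (trans (sym (lookup∘tabulate _ x)) ([]=⇒lookup x∈)))))
    (λ w → lookup⇒[]= x _ (trans (lookup∘tabulate _ x)
      (trans (sym (isYes≗does D)) (Equivalence.to T-≡ (fromWitness {a? = D} w)))))
    where D = ∔-member? A B x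

  ------------------------------------------------------------------------
  -- Arithmetic progressions

  -- S = {a + sd | 0 ≤ s ≤ k - 1}.  The terms need not be distinct: that S has
  -- k elements is not part of this definition.
  IsProgression : Subset n → (a d : Fin n) (k : ℕ) → Set
  IsProgression S a d k = ∀ x → x ∈ S ⇔ (∃[ s ] (s < k × x ≡ a ⊕ s · d))

IsSmallestPrimeDivisor : ℕ → ℕ → Set
IsSmallestPrimeDivisor p n = Prime p × p ∣ n × (∀ {q} → Prime q → q ∣ n → p ≤ q)

{-# OPTIONS --safe #-}
-- Let c = a + b.  The sums c + jd with 0 < j < k + l - 2 always lie in A ∔ B:
-- each has two representations by consecutive terms of A and of B, and both
-- are excluded only if 2d = 0.  These are k + l - 3 distinct elements because
-- d has order at least p(G).  If a ≠ b, then c itself is one element more; if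
-- the last terms of A and B differ, then so is c + (k + l - 2)d.  Hence both
-- ends agree, and A = B.  Only k + l - 2 consecutive sums are ever compared,
-- so it does not matter that c and c + (k + l - 2)d may coincide.
module Submission where

open import Defs
open import Algebra.Bundles using (AbelianGroup)
import Algebra.Properties.CommutativeSemigroup as CommutativeSemigroupProperties
import Algebra.Properties.Group as GroupProperties
import Algebra.Properties.Monoid.Mult as MonoidMult
open import Data.Empty using (⊥-elim)
open import Data.Fin.Base using (Fin; zero; suc; toℕ)
open import Data.Fin.Properties using (toℕ<n; toℕ-injective; toℕ-fromℕ<; suc-injective; _≟_)
open import Data.Fin.Subset using (Subset; ∣_∣; _∈_; _⊆_; _-_; ⁅_⁆)
open import Data.Fin.Subset.Properties
  using (x∈p⇒∣p-x∣<∣p∣; x∈p∧x≢y⇒x∈p-y; p⊆q⇒∣p∣≤∣q∣; ∣⁅x⁆∣≡1; x∈⁅x⁆; ⊆-antisym)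
open import Data.List.Base using (_∷_)
open import Data.List.Relation.Unary.All using (_∷_)
open import Data.Nat.Base
  using (ℕ; zero; suc; _+_; _∸_; _*_; _%_; _⊓_; _≤_; _<_; z≤n; s≤s; z<s; s≤s⁻¹; NonZero; NonTrivial;
         >-nonZero; >-nonZero⁻¹; ≢-nonZero⁻¹; nonTrivial⇒nonZero)
open import Data.Nat.Coprimality using (Coprime; coprime-divisor)
open import Data.Nat.Divisibility
  using (_∣_; ∣⇒≤; 0∣⇒≡0; ∣-trans; m∣m*n; n∣m⇒m%n≡0; m%n≡0⇒n∣m; hasNonTrivialDivisor)
open import Data.Nat.DivMod using (m%n<n; %-distribˡ-+; m%n%n≡m%n; m<n⇒m%n≡m)
open import Data.Nat.ListAction using (product)
open import Data.Nat.Primality using (Prime; _Rough_)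
open import Data.Nat.Primality.Factorisation using (factorise)
open import Data.Nat.Properties
  using (+-suc; +-comm; +-monoʳ-≤; ≤-refl; ≤-reflexive; ≤-trans; <-≤-trans; ≤-<-trans;
         <⇒≤; ≤⇒≯; <-cmp; n≤1+n; m≤m+n; m≤n+m; m≤n⇒m<n∨m≡n; m⊓n≤m; m⊓n+n∸m≡n;
         m∸n≤m; m<n⇒0<n∸m; m≤n+o⇒m∸n≤o; m+[n∸m]≡n)
open import Data.Product.Base using (∃-syntax; _×_; _,_)
open import Data.Sum.Base using (_⊎_; inj₁; inj₂)
open import Function.Base using (_∘_)
open import Function.Bundles using (Equivalence)
open import Function.Definitions using (Injective)
open import Relation.Binary.Definitions using (tri<; tri≈; tri>)
open import Relation.Binary.PropositionalEquality
open import Relation.Nullary.Decidable using (yes; no)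
open import Relation.Nullary.Negation using (¬_; contradiction)

-- Divisors below the smallest prime factor

prime-divisor : ∀ m .{{_ : NonTrivial m}} → ∃[ q ] (Prime q × q ∣ m)
prime-divisor m@(suc (suc _)) with factorise m
... | record { factors = q ∷ qs ; isFactorisation = eq ; factorsPrime = q-prime ∷ _ } =
  q , q-prime , subst (q ∣_) (sym eq) (m∣m*n (product qs))

-- A nontrivial divisor of `n` below `p` would have a prime factor, which divides `n` and is still
-- below `p`.
smallestPrimeDivisor⇒rough : ∀ {p n} → IsSmallestPrimeDivisor p n → p Rough n
smallestPrimeDivisor⇒rough (_ , _ , minimal) (hasNonTrivialDivisor {m} m<p m∣n)
  with q , q-prime , q∣m ← prime-divisor m =
  ≤⇒≯ (minimal q-prime (∣-trans q∣m m∣n)) (≤-<-trans (∣⇒≤ {{nonTrivial⇒nonZero m}} q∣m) m<p)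

rough⇒coprime : ∀ {p n u} .{{_ : NonZero u}} → p Rough n → u < p → Coprime n u
rough⇒coprime {u = u} rough u<p {zero} (_ , 0∣u) = contradiction (0∣⇒≡0 0∣u) (≢-nonZero⁻¹ u)
rough⇒coprime rough u<p {suc zero} _ = refl
rough⇒coprime rough u<p {suc (suc _)} (d∣n , d∣u) =
  contradiction (hasNonTrivialDivisor (≤-<-trans (∣⇒≤ d∣u) u<p) d∣n) rough

bounded-split : ∀ {x y i} → i ≤ x + y → ∃[ s ] ∃[ t ] (s ≤ x × t ≤ y × s + t ≡ i)
bounded-split {x} {y} {i} i≤x+y =
  -- The first summand takes as much of `i` as its bound `x` allows, the second takes the rest.
  x ⊓ i , i ∸ x , m⊓n≤m x i , m≤n+o⇒m∸n≤o i x i≤x+y , m⊓n+n∸m≡n x i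

-- Induction on `N`: deleting `f zero` shrinks `S`, and by injectivity the other values survive.
injective-into⇒≤∣∣ : ∀ {n N} (S : Subset n) (f : Fin N → Fin n) →
                     Injective _≡_ _≡_ f → (∀ i → f i ∈ S) → N ≤ ∣ S ∣
injective-into⇒≤∣∣ {N = zero} S f inj f∈S = z≤n
injective-into⇒≤∣∣ {N = suc N} S f inj f∈S = ≤-<-trans
  (injective-into⇒≤∣∣ (S - f zero) (f ∘ suc) (suc-injective ∘ inj)
    (λ i → x∈p∧x≢y⇒x∈p-y (f∈S (suc i)) (λ eq → contradiction (inj eq) λ ())))
  (x∈p⇒∣p-x∣<∣p∣ (f∈S zero))

module _ {n : ℕ} .{{_ : NonZero n}} where

  open AbelianGroup (ℤ/ n) using (group; monoid; commutativeSemigroup; identityʳ; assoc)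
  open GroupProperties group using (∙-cancelˡ; identityʳ-unique)
  open MonoidMult monoid using (×-homo-+)
  open CommutativeSemigroupProperties commutativeSemigroup using (interchange)

  -- Multiples of d in ℤ/n

  toℕ-⊕ : (x y : Fin n) → toℕ (x ⊕ y) ≡ (toℕ x + toℕ y) % n
  toℕ-⊕ x y = toℕ-fromℕ< (m%n<n (toℕ x + toℕ y) n)

  toℕ-𝟘 : toℕ (𝟘 {n}) ≡ 0
  toℕ-𝟘 = trans (toℕ-fromℕ< (m%n<n 0 n)) (m<n⇒m%n≡m (>-nonZero⁻¹ n))

  toℕ-· : ∀ u (d : Fin n) → toℕ (u · d) % n ≡ (u * toℕ d) % n
  toℕ-· zero d = cong (_% n) toℕ-𝟘
  toℕ-· (suc u) d = begin
    toℕ (d ⊕ u · d) % n                      ≡⟨ cong (_% n) (toℕ-⊕ d (u · d)) ⟩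
    (toℕ d + toℕ (u · d)) % n % n            ≡⟨ m%n%n≡m%n (toℕ d + toℕ (u · d)) n ⟩
    (toℕ d + toℕ (u · d)) % n                ≡⟨ %-distribˡ-+ (toℕ d) (toℕ (u · d)) n ⟩
    (toℕ d % n + toℕ (u · d) % n) % n        ≡⟨ cong (λ z → (toℕ d % n + z) % n) (toℕ-· u d) ⟩
    (toℕ d % n + (u * toℕ d) % n) % n        ≡⟨ %-distribˡ-+ (toℕ d) (u * toℕ d) n ⟨
    (toℕ d + u * toℕ d) % n                  ∎
    where open ≡-Reasoning

  ·≡𝟘⇒∣ : ∀ u (d : Fin n) → u · d ≡ 𝟘 → n ∣ u * toℕ d
  ·≡𝟘⇒∣ u d u·d≡𝟘 = m%n≡0⇒n∣m _ n (begin
    (u * toℕ d) % n    ≡⟨ toℕ-· u d ⟨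
    toℕ (u · d) % n    ≡⟨ cong (λ x → toℕ x % n) u·d≡𝟘 ⟩
    toℕ (𝟘 {n}) % n    ≡⟨ cong (_% n) toℕ-𝟘 ⟩
    0 % n              ≡⟨ m<n⇒m%n≡m (>-nonZero⁻¹ n) ⟩
    0                  ∎)
    where open ≡-Reasoning

  -- If ud = 0, then `n` divides u · `toℕ d`. As `n` is coprime to `u`, it divides `toℕ d`, which is
  -- less than `n` and hence 0.
  rough⇒·≢𝟘 : ∀ {p u} {d : Fin n} .{{_ : NonZero u}} → p Rough n → u < p → d ≢ 𝟘 → u · d ≢ 𝟘
  rough⇒·≢𝟘 {u = u} {d} rough u<p d≢𝟘 u·d≡𝟘 = d≢𝟘 (toℕ-injective (begin
    toℕ d      ≡⟨ m<n⇒m%n≡m (toℕ<n d) ⟨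
    toℕ d % n  ≡⟨ n∣m⇒m%n≡0 (toℕ d) n (coprime-divisor (rough⇒coprime rough u<p) (·≡𝟘⇒∣ u d u·d≡𝟘)) ⟩
    0          ≡⟨ toℕ-𝟘 ⟨
    toℕ 𝟘      ∎))
    where open ≡-Reasoning

  InjectiveBelow : ℕ → Fin n → Set
  InjectiveBelow N d = ∀ {i j} → i < N → j < N → i · d ≡ j · d → i ≡ j

  rough⇒·-distinct : ∀ {p i j} {d : Fin n} → p Rough n → d ≢ 𝟘 → i < j → j < p → i · d ≢ j · d
  rough⇒·-distinct {i = i} {j} {d} rough d≢𝟘 i<j j<p eq =
    -- Equal multiples would give (j - i)d = 0 with 0 < j - i < p.
    rough⇒·≢𝟘 {{>-nonZero (m<n⇒0<n∸m i<j)}} rough (≤-<-trans (m∸n≤m j i) j<p) d≢𝟘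
      (identityʳ-unique (i · d) ((j ∸ i) · d) (begin
        i · d ⊕ (j ∸ i) · d  ≡⟨ ×-homo-+ d i (j ∸ i) ⟨
        (i + (j ∸ i)) · d    ≡⟨ cong (_· d) (m+[n∸m]≡n (<⇒≤ i<j)) ⟩
        j · d                ≡⟨ eq ⟨
        i · d                ∎))
    where open ≡-Reasoning

  rough⇒injectiveBelow : ∀ {p} {d : Fin n} → p Rough n → d ≢ 𝟘 → InjectiveBelow p d
  rough⇒injectiveBelow rough d≢𝟘 {i} {j} i<p j<p eq with <-cmp i j
  ... | tri< i<j _ _ = contradiction eq (rough⇒·-distinct rough d≢𝟘 i<j j<p)
  ... | tri≈ _ i≡j _ = i≡j
  ... | tri> _ _ j<i = contradiction (sym eq) (rough⇒·-distinct rough d≢𝟘 j<i i<p)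

  -- Arithmetic progressions and their sums

  progression⊆⇒≤∣∣ : ∀ {p N} {d c : Fin n} {S : Subset n} → InjectiveBelow p d → N ≤ p →
                     (∀ {j} → j < N → c ⊕ j · d ∈ S) → N ≤ ∣ S ∣
  progression⊆⇒≤∣∣ {d = d} {c} {S} inj N≤p c+jd∈S = injective-into⇒≤∣∣ S (λ j → c ⊕ toℕ j · d)
    (λ {i} {j} eq → toℕ-injective
      (inj (<-≤-trans (toℕ<n i) N≤p) (<-≤-trans (toℕ<n j) N≤p) (∙-cancelˡ c _ _ eq)))
    (λ j → c+jd∈S (toℕ<n j))

  ·-𝟘 : ∀ s → s · 𝟘 {n} ≡ 𝟘
  ·-𝟘 zero = refl
  ·-𝟘 (suc s) = trans (⊕-identityˡ (s · 𝟘)) (·-𝟘 s)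

  -- With d = 0 every term equals `a`, which leaves room for one element only.
  difference≢𝟘 : ∀ {S : Subset n} {a d k} → IsProgression S a d k → 1 < ∣ S ∣ → d ≢ 𝟘
  difference≢𝟘 {S} {a} S-prog 1<∣S∣ refl =
    ≤⇒≯ (≤-trans (p⊆q⇒∣p∣≤∣q∣ S⊆⁅a⁆) (≤-reflexive (∣⁅x⁆∣≡1 a))) 1<∣S∣
    where
    S⊆⁅a⁆ : S ⊆ ⁅ a ⁆
    S⊆⁅a⁆ {x} x∈S with s , _ , x≡ ← Equivalence.to (S-prog x) x∈S =
      subst (_∈ ⁅ a ⁆) (sym (trans x≡ (trans (cong (a ⊕_) (·-𝟘 s)) (identityʳ a)))) (x∈⁅x⁆ a)

  progression-unique : ∀ {S T : Subset n} {a d k} →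
                       IsProgression S a d k → IsProgression T a d k → S ≡ T
  progression-unique S-prog T-prog = ⊆-antisym
    (λ {x} → Equivalence.from (T-prog x) ∘ Equivalence.to (S-prog x))
    (λ {x} → Equivalence.from (S-prog x) ∘ Equivalence.to (T-prog x))

  next-term : ∀ (c d : Fin n) s → c ⊕ suc s · d ≡ (c ⊕ s · d) ⊕ d
  next-term c d s = trans (cong (c ⊕_) (⊕-comm d (s · d))) (sym (assoc c (s · d) d))

  -- Here x = a + sd and y = b + td: then x + (y + d) = (x + d) + y are two
  -- representations of the same sum, and x = y + d, x + d = y give 2d = 0.
  consecutive-meetings : ∀ (x y d : Fin n) → x ≡ y ⊕ d → x ⊕ d ≡ y → 2 · d ≡ 𝟘
  consecutive-meetings x y d refl y+2d≡y = identityʳ-unique y (2 · d) (begin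
    y ⊕ (d ⊕ (d ⊕ 𝟘))  ≡⟨ cong (λ z → y ⊕ (d ⊕ z)) (identityʳ d) ⟩
    y ⊕ (d ⊕ d)        ≡⟨ assoc y d d ⟨
    y ⊕ d ⊕ d          ≡⟨ y+2d≡y ⟩
    y                  ∎)
    where open ≡-Reasoning

  module _ {A B : Subset n} {a b d : Fin n} {k l : ℕ}
           (A-prog : IsProgression A a d k) (B-prog : IsProgression B b d l) where

    term-sum : ∀ s t → (a ⊕ s · d) ⊕ (b ⊕ t · d) ≡ (a ⊕ b) ⊕ (s + t) · d
    term-sum s t = trans (interchange a (s · d) b (t · d)) (cong ((a ⊕ b) ⊕_) (sym (×-homo-+ d s t)))

    term-sum∈∔ : ∀ {s t} → s < k → t < l → a ⊕ s · d ≢ b ⊕ t · d → (a ⊕ b) ⊕ (s + t) · d ∈ A ∔ B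
    term-sum∈∔ {s} {t} s<k t<l ≢ = Equivalence.from ∈-∔
      ( _ , _ , Equivalence.from (A-prog _) (s , s<k , refl)
      , Equivalence.from (B-prog _) (t , t<l , refl) , ≢ , sym (term-sum s t) )

    -- The index pairs (s, 1 + t) and (1 + s, t) give the same sum; the terms of at least one pair
    -- differ, since otherwise 2d = 0.
    inner-sum∈∔ : ∀ {s t} → 2 · d ≢ 𝟘 → suc s < k → suc t < l → (a ⊕ b) ⊕ suc (s + t) · d ∈ A ∔ B
    inner-sum∈∔ {s} {t} 2d≢𝟘 1+s<k 1+t<l
      with (a ⊕ s · d) ≟ (b ⊕ suc t · d) | (a ⊕ suc s · d) ≟ (b ⊕ t · d)
    ... | no ≢ | _ = subst (λ j → (a ⊕ b) ⊕ j · d ∈ A ∔ B) (+-suc s t)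
                       (term-sum∈∔ (≤-trans (n≤1+n _) 1+s<k) 1+t<l ≢)
    ... | yes _ | no ≢ = term-sum∈∔ 1+s<k (≤-trans (n≤1+n _) 1+t<l) ≢
    ... | yes eq₁ | yes eq₂ = contradiction
      (consecutive-meetings (a ⊕ s · d) (b ⊕ t · d) d
        (trans eq₁ (next-term b d t)) (trans (sym (next-term a d s)) eq₂))
      2d≢𝟘

  -- Here `k` and `l` count the terms beyond the third, so that K + L - 3 computes to `k + L`
  -- without truncated subtraction.
  same-progression : ∀ {p k l} {A B : Subset n} {a b d : Fin n} → InjectiveBelow p d →
    let K = 3 + k ; L = 3 + l in k + L < p →
    IsProgression A a d K → IsProgression B b d L → ∣ A ∔ B ∣ ≡ k + L → A ≡ B
  same-progression {p} {k} {l} {A} {B} {a} {b} {d} inj k+L<p A-prog B-prog size =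
    conclude a≡b
    where
    -- One more than the assumed size of `A ∔ B`; `k+L<p` is literally `N ≤ p`.
    N = suc (k + (3 + l))

    -- The start `c` is left free: it will be a + b in `a≡b` and a + b + d in `last≡`.
    ¬-N-sums : ∀ {c} → ¬ (∀ {j} → j < N → c ⊕ j · d ∈ A ∔ B)
    ¬-N-sums sums = ≤⇒≯ (≤-reflexive size) (progression⊆⇒≤∣∣ inj k+L<p sums)

    3≤k+L : 3 ≤ k + (3 + l)
    3≤k+L = ≤-trans (m≤m+n 3 l) (m≤n+m (3 + l) k)

    2d≢𝟘 : 2 · d ≢ 𝟘
    2d≢𝟘 2d≡𝟘 with () ← inj {2} {0} (<-≤-trans 3≤k+L (<⇒≤ k+L<p)) (≤-<-trans z≤n k+L<p) 2d≡𝟘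

    inner : ∀ {i} → i < k + (3 + l) → (a ⊕ b) ⊕ suc i · d ∈ A ∔ B
    inner {i} i<
      -- The bound on `i` amounts to i ≤ (1 + k) + (1 + l), and these bounds on `s` and `t` leave
      -- each progression one further term.
      with s , t , s≤ , t≤ , refl ← bounded-split {1 + k} {1 + l} {i}
             (s≤s⁻¹ (subst (i <_) (trans (+-suc k _) (cong suc (+-suc k _))) i<)) =
      inner-sum∈∔ A-prog B-prog 2d≢𝟘 (s≤s (s≤s s≤)) (s≤s (s≤s t≤))

    a≡b : a ≡ b
    a≡b with a ≟ b
    ... | yes eq = eq
    ... | no a≢b = ⊥-elim (¬-N-sums sums)
      where
      sums : ∀ {j} → j < N → (a ⊕ b) ⊕ j · d ∈ A ∔ B
      sums {zero} _ = term-sum∈∔ A-prog B-prog z<s z<s (a≢b ∘ λ eq →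
        trans (sym (identityʳ a)) (trans eq (identityʳ b)))
      sums {suc i} (s≤s i<) = inner i<

    last≡ : a ⊕ (2 + k) · d ≡ b ⊕ (2 + l) · d
    last≡ with (a ⊕ (2 + k) · d) ≟ (b ⊕ (2 + l) · d)
    ... | yes eq = eq
    ... | no ≢ = ⊥-elim (¬-N-sums sums)
      where
      sums : ∀ {j} → j < N → ((a ⊕ b) ⊕ d) ⊕ j · d ∈ A ∔ B
      sums {j} (s≤s j≤) = subst (_∈ A ∔ B) (sym (assoc (a ⊕ b) d (j · d))) (go (m≤n⇒m<n∨m≡n j≤))
        where
        go : ∀ {j} → j < k + (3 + l) ⊎ j ≡ k + (3 + l) → (a ⊕ b) ⊕ suc j · d ∈ A ∔ B
        go (inj₁ j<) = inner j<
        -- The top index is (2 + k) + (2 + l), the sum of the two last terms.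
        go (inj₂ refl) = subst (λ j → (a ⊕ b) ⊕ j · d ∈ A ∔ B)
          (cong suc (sym (+-suc k _)))
          (term-sum∈∔ A-prog B-prog {2 + k} {2 + l} ≤-refl ≤-refl ≢)

    -- The indices of both last terms lie where multiples of `d` are distinct.
    2+k<p : 2 + k < p
    2+k<p = ≤-<-trans (≤-trans (≤-reflexive (+-comm 2 k)) (+-monoʳ-≤ k (s≤s (s≤s z≤n)))) k+L<p

    2+l<p : 2 + l < p
    2+l<p = ≤-<-trans (≤-trans (n≤1+n (2 + l)) (m≤n+m (3 + l) k)) k+L<p

    conclude : a ≡ b → A ≡ B
    -- Once a = b, cancelling `a` in `last≡` leaves (2 + k)d = (2 + l)d, so k = l and both sets are
    -- the same progression.
    conclude refl with refl ← inj 2+k<p 2+l<p (∙-cancelˡ a _ _ last≡) =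
      progression-unique A-prog B-prog

theorem5p1 : (n : ℕ) .{{_ : NonZero n}} → 2 ≤ n →
    (p : ℕ) → IsSmallestPrimeDivisor p n →
    (k l : ℕ) → 3 ≤ k → 3 ≤ l → k + l ∸ 3 < p →
    (A B : Subset n) → ∣ A ∣ ≡ k → ∣ B ∣ ≡ l →
    (∃[ a ] ∃[ b ] ∃[ d ] (IsProgression A a d k × IsProgression B b d l)) →
    ∣ A ∔ B ∣ ≡ ∣ A ∣ + ∣ B ∣ ∸ 3 →
    A ≡ B
-- Matching on the bounds 3 ≤ k and 3 ≤ l exposes three successors in each length, so the
-- subtractions of 3 reduce.
theorem5p1 n _ p p-spd _ _ (s≤s (s≤s (s≤s z≤n))) (s≤s (s≤s (s≤s z≤n))) k+l-3<p A B ∣A∣≡ ∣B∣≡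
  (a , b , d , A-prog , B-prog) size =
  same-progression
    (rough⇒injectiveBelow (smallestPrimeDivisor⇒rough p-spd)
      (difference≢𝟘 A-prog (subst (1 <_) (sym ∣A∣≡) (s≤s z<s))))
    k+l-3<p A-prog B-prog
    (trans size (cong₂ (λ x y → x + y ∸ 3) ∣A∣≡ ∣B∣≡))
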